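{- For every program $\mathit{Ds}$ of the trait calculus described in the context that flattens to $\mathit{Ds}'$, the flattened program $\mathit{Ds}'$ is well-typed and verified; that is, for every declaration $\mathit{Name}=\mathit{Body}$ in $\mathit{Ds}'$ we have $\mathit{Ds}';\mathit{Name}\vdash\mathit{Body}:\mathit{OK}$.
   Context: Trait calculus (\textsc{TraitCbC}). A program is a list $\mathit{Ds}$ of declarations $\mathit{Name}=E$ (names unique, no circular trait definitions), where $\mathit{Name}$ is a trait name $t$ or class name $C$, and $E::=\mathit{Body}\mid t\mid E+E\mid E[\mathtt{makeAbstract}\ m]$. A body is $\{\mathtt{interface}?\ [\mathit{Cs}]\ \mathit{Ms}\}$ with implemented interfaces $\mathit{Cs}$ and methods $\mathit{Ms}$ with distinct names. A method is $\mathit{MH}\ e?;$ (abstract if $e$ absent) with header $S\ \mathtt{method}\ C\ m(C_1x_1\dots C_nx_n)$; $S$ has precondition $\mathit{Pre}(S)$ and postcondition $\mathit{Post}(S)$ in a parametric logic supporting a commutative, associative conjunction $\&$ and transitive implication $\Rightarrow$. Expressions: $e::=x\mid e.m(e_1\dots e_n)\mid\mathtt{new}\ C(e_1\dots e_n)$; fields are emulated by argument-less abstract methods (getters). The underlying verification is assumed sound and modular (a method can be verified from its declaration and the specifications of methods it uses). Typing judgment $\Gamma\vdash e:C\dashv P\models P'$ (knowledge $P$, obligation $P'$): variables give $\Gamma\vdash x:\Gamma(x)\dashv\mathtt{result}:\Gamma(x)\&\mathtt{result}=x\models\mathit{true}$; a call $e_0.m(e_1\dots e_n)$ to a method $S\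 \mathtt{method}\ C\ m(C_1x_1\dots C_nx_n)$ of $C_0$, with $\Gamma\vdash e_i:C_i\dashv P_i\models P'_i$, fresh $x'_i$ and $S'=S[\mathtt{this}:=x'_0,x_i:=x'_i]$, has type $C$, knowledge $\mathtt{result}:C\&P_0[\mathtt{result}:=x'_0]\&\dots\&P_n[\mathtt{result}:=x'_n]\&(\mathit{Pre}(S')\Rightarrow\mathit{Post}(S'))$ and obligation $P'_0\&\dots\&P'_n\&\mathit{Pre}(S')$; $\mathtt{new}\ C(e_1\dots e_n)$, with getters $S_i\ \mathtt{method}\ C_i\ x_i()$ of $C$, has type $C$, knowledge $\mathtt{result}:C\&\bigwedge_i(P_i[\mathtt{result}:=x'_i]\&(\mathit{Pre}(S'_i)\Rightarrow\mathtt{result}.x_i()=x'_i))$ and obligation $\bigwedge_iP'_i\&\bigwedge_i\mathit{Pre}(S'_i)$, $S'_i=S_i[\mathtt{this}:=\mathtt{result}]$; subsumption to supertypes. A concrete method $S\ \mathtt{method}\ C\ m(C_1x_1\dots C_nx_n)\ e;$ satisfies $\mathit{Ds};\mathit{Name}\vdash M:\mathit{OK}$ iff, for $\Gamma=\mathtt{this}:\mathit{Name},x_i:C_i$, $\Gamma\vdash e:C\dashv P\models P'$ and the verifier proves $\mathit{Ds}\vdash(\Gamma\&\mathit{Pre}(S)\&P)\models(P'\&\mathit{Post}(S))$; abstract methods are always OK; a body is OK iff all its methods are. Body composition $\{[\mathit{Cs}_1]\mathit{Ms}_1\}+\{[\mathit{Cs}_2]\mathit{Ms}_2\}=\{[\mathit{Cs}_1\cup\mathit{Cs}_2]\mathit{Ms}_1+\mathit{Ms}_2\}$: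 methods present in only one list are kept; a concrete method (spec $S$) plus an abstract one (spec $S'$) with the same name yields the concrete one if $\mathit{Pre}(S')\Rightarrow\mathit{Pre}(S)$ and $\mathit{Post}(S)\Rightarrow\mathit{Post}(S')$; two abstract methods yield the one with the stronger specification in this sense (the first if it qualifies); otherwise (e.g. two concrete methods) composition is undefined. $\mathit{Body}[\mathtt{makeAbstract}\ m]$ removes the implementation of $m$, keeping its header. Flattening: $D_1\dots D_n$ flattens to $D'_1\dots D'_n$ if $D'_1\dots D'_n\vdash D_i\Downarrow D'_i$ for all $i$. $\mathit{Ds}\vdash\mathit{Name}=E\Downarrow\mathit{Name}=\mathit{Body}$ if $\mathit{Ds};\mathit{Name}\vdash E\Downarrow\mathit{Body}$ and, when $\mathit{Name}$ is a class, all abstract methods of $\mathit{Body}$ are argument-less getters. Trait expressions flatten as: $\mathit{Ds};\mathit{Name}\vdash\mathit{Body}\Downarrow\mathit{Body}'$ where $\mathit{Body}'$ is $\mathit{Body}$ extended by the (composed) headers of the interface methods of $\mathit{Cs}$ not already in $\mathit{Body}$, provided $\mathit{Ds};\mathit{Name}\vdash\mathit{Body}':\mathit{OK}$; $t\Downarrow\mathit{Ds}(t)$; $E_1+E_2\Downarrow\mathit{Body}_1+\mathit{Body}_2$ if $E_i\Downarrow\mathit{Body}_i$; $E[\mathtt{makeAbstract}\ m]\Downarrow\mathit{Body}[\mathtt{makeAbstract}\ m]$ if $E\Downarrow\mathit{Body}$.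
   Formalization: Two methods with the same name compose only if they also have the same return type and parameter list; with differing signatures the claim fails, since a caller checked against the abstract header may no longer be typable. -}

module Defs where

open import Data.Bool using (Bool; true; false; _∧_; if_then_else_)
open import Data.List using (List; []; _∷_; _++_; [_]; map; filter; filterᵇ; foldr; zipWith; null)
open import Data.List.Membership.Propositional using (_∈_; _∉_)
open import Data.List.Relation.Binary.Pointwise using (Pointwise)
open import Data.List.Relation.Unary.All using (All)
open import Data.List.Relation.Unary.Unique.Propositional using (Unique)
open import Data.Maybe using (Maybe; just; nothing; is-nothing)
open import Data.Nat using (ℕ; _≡ᵇ_)
open import Data.Nat.Properties using (_≟_)
open import Data.List.Membership.DecPropositional _≟_ using (_∉?_)
open import Data.Product using (_×_; _,_; proj₁; proj₂; ∃-syntax)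
open import Relation.Binary.Construct.Closure.Transitive using (TransClosure)
open import Relation.Binary.PropositionalEquality using (_≡_)
open import Relation.Nullary using (¬_)

TraitName ClassName MethodName ParamName : Set
TraitName  = ℕ
ClassName  = ℕ
MethodName = ℕ
ParamName  = ℕ

data Name : Set where
  trait : TraitName → Name
  class : ClassName → Name

-- Specifications are formulas over SVar.  Knowledge and obligations are
-- formulas over Var, so the generated variables `fresh k` cannot occur in any
-- specification.
data SVar : Set where
  this result : SVar
  param       : ParamName → SVar

data Var : Set where
  src   : SVar → Var
  fresh : ℕ → Var

-- The parametric logic.  `Formula V` has free variables in V; every
-- substitution of the calculus replaces variables by variables, so `rename`
-- is simultaneous (capture-avoiding) substitution.
record Logic : Set₁ where
  infix  8 _∶_ _≐_
  infixr 6 _&_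
  infixr 5 _⇒_
  infix  3 ⊢_
  field
    Formula : Set → Set
    tt      : ∀ {V} → Formula V
    _&_ _⇒_ : ∀ {V} → Formula V → Formula V → Formula V
    _∶_     : ∀ {V} → V → Name → Formula V
    _≐_     : ∀ {V} → V → V → Formula V
    -- `getter x m y` is the formula  x.m() = y
    getter  : ∀ {V} → V → MethodName → V → Formula V
    rename  : ∀ {V W} → (V → W) → Formula V → Formula W

    rename-tt : ∀ {V W} (σ : V → W) → rename σ tt ≡ tt
    rename-&  : ∀ {V W} (σ : V → W) P Q → rename σ (P & Q) ≡ (rename σ P & rename σ Q)
    rename-⇒  : ∀ {V W} (σ : V → W) P Q → rename σ (P ⇒ Q) ≡ (rename σ P ⇒ rename σ Q)
    rename-∶  : ∀ {V W} (σ : V → W) x N → rename σ (x ∶ N) ≡ (σ x ∶ N)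
    rename-≐  : ∀ {V W} (σ : V → W) x y → rename σ (x ≐ y) ≡ (σ x ≐ σ y)
    rename-getter : ∀ {V W} (σ : V → W) x m y →
                    rename σ (getter x m y) ≡ getter (σ x) m (σ y)

    -- Logical validity.
    ⊢_        : ∀ {V} → Formula V → Set
    ⊢-rename  : ∀ {V W} (σ : V → W) {P} → ⊢ P → ⊢ rename σ P
    ⇒-refl    : ∀ {V} {P : Formula V} → ⊢ P ⇒ P
    ⇒-trans   : ∀ {V} {P Q R : Formula V} → ⊢ P ⇒ Q → ⊢ Q ⇒ R → ⊢ P ⇒ R
    ⇒-mono    : ∀ {V} {P P′ Q Q′ : Formula V} →
                ⊢ P′ ⇒ P → ⊢ Q ⇒ Q′ → ⊢ (P ⇒ Q) ⇒ (P′ ⇒ Q′)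
    &-mono    : ∀ {V} {P P′ Q Q′ : Formula V} →
                ⊢ P ⇒ P′ → ⊢ Q ⇒ Q′ → ⊢ (P & Q) ⇒ (P′ & Q′)
    &-comm    : ∀ {V} {P Q : Formula V} → ⊢ (P & Q) ⇒ (Q & P)
    &-assoc   : ∀ {V} {P Q R : Formula V} → ⊢ ((P & Q) & R) ⇒ (P & (Q & R))
    &-tt-elim  : ∀ {V} {P : Formula V} → ⊢ (P & tt) ⇒ P
    &-tt-intro : ∀ {V} {P : Formula V} → ⊢ P ⇒ (P & tt)

data Expr : Set where
  var  : SVar → Expr
  call : Expr → MethodName → List Expr → Expr
  new  : ClassName → List Expr → Expr

module _ (L : Logic) where
  open Logic L

  record Spec : Set where
    constructor spec
    field
      Pre Post : Formula SVar
  open Spec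

  record Method : Set where
    constructor method
    field
      S      : Spec
      ret    : ClassName
      name   : MethodName
      params : List (ParamName × ClassName)
      impl   : Maybe Expr
  open Method

  record Body : Set where
    constructor body
    field
      isInterface : Bool
      interfaces  : List ClassName
      methods     : List Method
  open Body

  infixl 6 _⊞_
  data TraitExpr : Set where
    lit             : Body → TraitExpr
    ref             : TraitName → TraitExpr
    _⊞_             : TraitExpr → TraitExpr → TraitExpr
    _[makeAbstract_] : TraitExpr → MethodName → TraitExpr

  Program FlatProgram : Set
  Program     = List (Name × TraitExpr)
  FlatProgram = List (Name × Body)

  traits : TraitExpr → List TraitName
  traits (lit _)               = []
  traits (ref t)               = [ t ]
  traits (E₁ ⊞ E₂)             = traits E₁ ++ traits E₂
  traits (E [makeAbstract _ ]) = traits E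

  literals : TraitExpr → List Body
  literals (lit B)               = [ B ]
  literals (ref _)               = []
  literals (E₁ ⊞ E₂)             = literals E₁ ++ literals E₂
  literals (E [makeAbstract _ ]) = literals E

  Uses : Program → TraitName → TraitName → Set
  Uses Ds t t′ = ∃[ E ] ((trait t , E) ∈ Ds × t′ ∈ traits E)

  record WellFormed (Ds : Program) : Set where
    field
      unique-names   : Unique (map proj₁ Ds)
      acyclic        : ∀ t → ¬ TransClosure (Uses Ds) t t
      unique-methods : ∀ {N E B} → (N , E) ∈ Ds → B ∈ literals E →
                       Unique (map name (methods B))

  -- S is at least as strong as S′.
  infix 4 _⊑_
  _⊑_ : Spec → Spec → Set
  S ⊑ S′ = (⊢ Pre S′ ⇒ Pre S) × (⊢ Post S ⇒ Post S′)

  SameSignature : Method → Method → Set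
  SameSignature M₁ M₂ = name M₁ ≡ name M₂ × ret M₁ ≡ ret M₂ × params M₁ ≡ params M₂

  data MethodSum (M₁ M₂ : Method) : Method → Set where
    conc-abs : ∀ {e} → SameSignature M₁ M₂ → impl M₁ ≡ just e → impl M₂ ≡ nothing →
               S M₁ ⊑ S M₂ → MethodSum M₁ M₂ M₁
    abs-conc : ∀ {e} → SameSignature M₁ M₂ → impl M₁ ≡ nothing → impl M₂ ≡ just e →
               S M₂ ⊑ S M₁ → MethodSum M₁ M₂ M₂
    abs-abs₁ : SameSignature M₁ M₂ → impl M₁ ≡ nothing → impl M₂ ≡ nothing →
               S M₁ ⊑ S M₂ → MethodSum M₁ M₂ M₁
    abs-abs₂ : SameSignature M₁ M₂ → impl M₁ ≡ nothing → impl M₂ ≡ nothing →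
               ¬ (S M₁ ⊑ S M₂) → S M₂ ⊑ S M₁ → MethodSum M₁ M₂ M₂

  data MethodsSum : List Method → List Method → List Method → Set where
    done  : ∀ {Ms₂} → MethodsSum [] Ms₂ Ms₂
    keep  : ∀ {M₁ Ms₁ Ms₂ Ms} → name M₁ ∉ map name Ms₂ →
            MethodsSum Ms₁ Ms₂ Ms → MethodsSum (M₁ ∷ Ms₁) Ms₂ (M₁ ∷ Ms)
    merge : ∀ {M₁ M₂ M Ms₁ Ms Ns₁ Ns₂} → MethodSum M₁ M₂ M →
            MethodsSum Ms₁ (Ns₁ ++ Ns₂) Ms →
            MethodsSum (M₁ ∷ Ms₁) (Ns₁ ++ M₂ ∷ Ns₂) (M ∷ Ms)

  -- Only bodies without the `interface` keyword compose.  Lists of interfaces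
  -- matter only up to membership, so ++ is the union.
  data BodySum : Body → Body → Body → Set where
    body-sum : ∀ {Cs₁ Cs₂ Ms₁ Ms₂ Ms} → MethodsSum Ms₁ Ms₂ Ms →
               BodySum (body false Cs₁ Ms₁) (body false Cs₂ Ms₂) (body false (Cs₁ ++ Cs₂) Ms)

  header : Method → Method
  header M = record M { impl = nothing }

  makeAbstract : MethodName → Body → Body
  makeAbstract m B = record B
    { methods = map (λ M → if name M ≡ᵇ m then header M else M) (methods B) }

  -- B offers every interface of B₀ and every method of B₀, the latter with the
  -- same signature and a specification at least as strong.
  record Conforms (B B₀ : Body) : Set where
    field
      conforms-interfaces : ∀ {C} → C ∈ interfaces B₀ → C ∈ interfaces B
      conforms-methods    : ∀ {M₀} → M₀ ∈ methods B₀ →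
                            ∃[ M ] (M ∈ methods B × SameSignature M M₀ × S M ⊑ S M₀)

  record Verifier : Set₁ where
    infix 3 _⊢_⊨_ _⊩_
    field
      _⊢_⊨_ : FlatProgram → Formula Var → Formula Var → Set

      -- Truth of a formula in every state of the given program.
      _⊩_   : FlatProgram → Formula Var → Set
      valid-true : ∀ {Ds P} → ⊢ P → Ds ⊩ P
      true-mp    : ∀ {Ds P Q} → Ds ⊩ P ⇒ Q → Ds ⊩ P → Ds ⊩ Q
      sound      : ∀ {Ds P Q} → Ds ⊢ P ⊨ Q → Ds ⊩ P ⇒ Q

      consequence : ∀ {Ds P P′ Q Q′} → ⊢ P′ ⇒ P → ⊢ Q ⇒ Q′ →
                    Ds ⊢ P ⊨ Q → Ds ⊢ P′ ⊨ Q′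

      -- Modularity: a trait is not a type of the language, and all that the
      -- assumption x ∶ t gives the verifier is the interfaces of t and the
      -- specified headers of its methods.  So a proof that uses it also goes
      -- through for any declared N that offers at least these.
      modular : ∀ {Ds t B₀ N B x P Q} → Unique (map proj₁ Ds) →
                (trait t , B₀) ∈ Ds → (N , B) ∈ Ds → Conforms B B₀ →
                Ds ⊢ x ∶ trait t & P ⊨ Q → Ds ⊢ x ∶ N & P ⊨ Q

  data Subtype (Ds : FlatProgram) : Name → Name → Set where
    sub-refl : ∀ {N} → Subtype Ds N N
    sub-step : ∀ {N B C N′} → (N , B) ∈ Ds → C ∈ interfaces B →
               Subtype Ds (class C) N′ → Subtype Ds N N′

  Context : Set
  Context = List (SVar × Name)

  ⋀ : List (Formula Var) → Formula Var
  ⋀ = foldr _&_ tt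

  contextFormula : Context → Formula Var
  contextFormula Γ = ⋀ (map (λ d → src (proj₁ d) ∶ proj₂ d) Γ)

  -- [result := x′]
  result≔ : ℕ → Var → Var
  result≔ k (src result)    = fresh k
  result≔ k (src this)      = src this
  result≔ k (src (param x)) = src (param x)
  result≔ k (fresh j)       = fresh j

  -- [x₁ := x′₁, …, xₙ := x′ₙ]
  params≔ : List ParamName → List ℕ → ParamName → Var
  params≔ (x ∷ xs) (k ∷ ks) y = if x ≡ᵇ y then fresh k else params≔ xs ks y
  params≔ _        _        y = src (param y)

  -- [this := x′₀, x₁ := x′₁, …, xₙ := x′ₙ]
  call≔ : ℕ → List ParamName → List ℕ → SVar → Var
  call≔ k₀ xs ks this      = fresh k₀
  call≔ k₀ xs ks result    = src result
  call≔ k₀ xs ks (param y) = params≔ xs ks y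

  -- [this := result]
  this≔result : SVar → Var
  this≔result this      = src result
  this≔result result    = src result
  this≔result (param y) = src (param y)

  getters : Body → List Method
  getters B = filterᵇ (λ M → is-nothing (impl M) ∧ null (params M)) (methods B)

  -- `Typed Ds Γ e N P P′ ks` is  Γ ⊢ e : N ⊣ P ⊨ P′,  where ks lists the
  -- variables generated in the derivation; freshness is the condition that all
  -- variables generated in a derivation are pairwise distinct.
  -- In `TypedArgs Ds Γ es Cs xs Ps Ps′ ks`, xs are the variables x′ᵢ chosen for
  -- the arguments, Ps the Pᵢ[result := x′ᵢ] and Ps′ the P′ᵢ.
  mutual
    data Typed (Ds : FlatProgram) (Γ : Context) :
         Expr → Name → Formula Var → Formula Var → List ℕ → Set where

      t-var : ∀ {x N} → (x , N) ∈ Γ →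
        Typed Ds Γ (var x) N (src result ∶ N & src result ≐ src x) tt []

      t-call : ∀ {e₀ es N₀ B M k₀ P₀ P₀′ ks₀ xs Ps Ps′ ks} →
        Typed Ds Γ e₀ N₀ P₀ P₀′ ks₀ →
        (N₀ , B) ∈ Ds → M ∈ methods B →
        TypedArgs Ds Γ es (map proj₂ (params M)) xs Ps Ps′ ks →
        Unique (k₀ ∷ ks₀ ++ ks) →
        let σ    = call≔ k₀ (map proj₁ (params M)) xs
            pre  = rename σ (Pre (S M))
            post = rename σ (Post (S M))
        in Typed Ds Γ (call e₀ (name M) es) (class (ret M))
             (src result ∶ class (ret M) & rename (result≔ k₀) P₀ & ⋀ Ps & (pre ⇒ post))
             (P₀′ & ⋀ Ps′ & pre)
             (k₀ ∷ ks₀ ++ ks)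

      t-new : ∀ {C B es xs Ps Ps′ ks} →
        (class C , B) ∈ Ds →
        TypedArgs Ds Γ es (map ret (getters B)) xs Ps Ps′ ks →
        Unique ks →
        let pre : Method → Formula Var
            pre M = rename this≔result (Pre (S M))
            getterFacts =
              zipWith (λ M k → pre M ⇒ getter (src result) (name M) (fresh k)) (getters B) xs
        in Typed Ds Γ (new C es) (class C)
             (src result ∶ class C & ⋀ (zipWith _&_ Ps getterFacts))
             (⋀ Ps′ & ⋀ (map pre (getters B)))
             ks

      t-sub : ∀ {e N N′ P P′ ks} →
        Typed Ds Γ e N P P′ ks → Subtype Ds N N′ → Typed Ds Γ e N′ P P′ ks

    data TypedArgs (Ds : FlatProgram) (Γ : Context) :
         List Expr → List ClassName → List ℕ →
         List (Formula Var) → List (Formula Var) → List ℕ → Set where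

      []  : TypedArgs Ds Γ [] [] [] [] [] []

      _∷_ : ∀ {e es C Cs k xs P P′ Ps Ps′ ksₑ ks} →
        Typed Ds Γ e (class C) P P′ ksₑ →
        TypedArgs Ds Γ es Cs xs Ps Ps′ ks →
        TypedArgs Ds Γ (e ∷ es) (C ∷ Cs) (k ∷ xs)
          (rename (result≔ k) P ∷ Ps) (P′ ∷ Ps′) (k ∷ ksₑ ++ ks)

  methodContext : Name → Method → Context
  methodContext N M = (this , N) ∷ map (λ p → param (proj₁ p) , class (proj₂ p)) (params M)

  -- `InheritedHeaders Ds ms Ns Cs Ns′`: composing Ns, from left to right,
  -- with the headers of the interfaces Cs whose names are not in ms gives Ns′.
  data InheritedHeaders (Ds : FlatProgram) (ms : List MethodName) :
       List Method → List ClassName → List Method → Set where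
    []  : ∀ {Ns} → InheritedHeaders Ds ms Ns [] Ns
    add : ∀ {Ns Ns₁ Ns′ C Cs B} → (class C , B) ∈ Ds → isInterface B ≡ true →
          MethodsSum Ns (filter (λ M → name M ∉? ms) (map header (methods B))) Ns₁ →
          InheritedHeaders Ds ms Ns₁ Cs Ns′ → InheritedHeaders Ds ms Ns (C ∷ Cs) Ns′

  module _ (V : Verifier) where
    open Verifier V

    data MethodOK (Ds : FlatProgram) (N : Name) (M : Method) : Set where
      abstract-ok : impl M ≡ nothing → MethodOK Ds N M
      concrete-ok : ∀ {e P P′ ks} → impl M ≡ just e →
        let Γ = methodContext N M in
        Typed Ds Γ e (class (ret M)) P P′ ks →
        Ds ⊢ contextFormula Γ & rename src (Pre (S M)) & P ⊨ P′ & rename src (Post (S M)) →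
        MethodOK Ds N M

    BodyOK : FlatProgram → Name → Body → Set
    BodyOK Ds N B = All (MethodOK Ds N) (methods B)

    data Flatten (Ds : FlatProgram) (N : Name) : TraitExpr → Body → Set where
      f-body : ∀ {i Cs Ms Ms′} → InheritedHeaders Ds (map name Ms) [] Cs Ms′ →
               BodyOK Ds N (body i Cs (Ms ++ Ms′)) →
               Flatten Ds N (lit (body i Cs Ms)) (body i Cs (Ms ++ Ms′))
      f-ref  : ∀ {t B} → (trait t , B) ∈ Ds → Flatten Ds N (ref t) B
      f-sum  : ∀ {E₁ E₂ B₁ B₂ B} → Flatten Ds N E₁ B₁ → Flatten Ds N E₂ B₂ →
               BodySum B₁ B₂ B → Flatten Ds N (E₁ ⊞ E₂) B
      f-abs  : ∀ {E B m} → Flatten Ds N E B →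
               Flatten Ds N (E [makeAbstract m ]) (makeAbstract m B)

    data FlattenDecl (Ds : FlatProgram) : Name × TraitExpr → Name × Body → Set where
      f-trait : ∀ {t E B} → Flatten Ds (trait t) E B → FlattenDecl Ds (trait t , E) (trait t , B)
      f-class : ∀ {C E B} → Flatten Ds (class C) E B →
                (∀ {M} → M ∈ methods B → impl M ≡ nothing → params M ≡ []) →
                FlattenDecl Ds (class C , E) (class C , B)

    FlattensTo : Program → FlatProgram → Set
    FlattensTo Ds Ds′ = Pointwise (FlattenDecl Ds′) Ds Ds′

{-# OPTIONS --safe #-}

-- Composition and makeAbstract only strengthen the headers that a body offers,
-- so the flattened body of N conforms to the body of every trait t it is built
-- from.  A method verified under this : t can be retyped under this : N: its
-- knowledge becomes stronger, up to replacing assumptions x : t by x : N, and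
-- its obligation weaker, so modularity of the verifier transfers the proof.
-- Trait references are acyclic, so the bodies of the referenced traits may be
-- assumed OK by well-founded induction.

module Submission where

open import Defs
open import Data.Bool using (true; false; if_then_else_)
open import Data.Fin using (Fin)
open import Data.Fin.Induction using (spo-wellFounded)
open import Data.List using (List; []; _∷_; map; zipWith; lookup; length)
open import Data.List.Membership.Propositional using (_∈_)
open import Data.List.Membership.Propositional.Properties using (∈-++⁺ˡ; ∈-++⁺ʳ; ∈-++⁻; ∈-map⁺)
open import Data.List.Relation.Binary.Pointwise using (Pointwise; []; _∷_)
open import Data.List.Relation.Unary.All as All using (All; []; _∷_)
open import Data.List.Relation.Unary.All.Properties using (++⁻ˡ; ++⁻ʳ; ++⁺; map⁺)
open import Data.List.Relation.Unary.Any using (here; there; index)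
open import Data.List.Relation.Unary.Any.Properties using (lookup-index)
open import Data.List.Relation.Unary.AllPairs using (_∷_)
open import Data.List.Relation.Unary.Unique.Propositional using (Unique)
open import Data.Nat using (_≡ᵇ_)
open import Data.Product using (_×_; _,_; proj₁; ∃-syntax)
open import Data.Sum using (inj₁; inj₂)
open import Function using (_on_; _∘_)
open import Induction.WellFounded using (Acc; acc; WellFounded)
open import Relation.Binary.Construct.Closure.Transitive using (TransClosure; [_]; _++_)
import Relation.Binary.Construct.On as On
open import Relation.Binary.PropositionalEquality using (_≡_; refl; sym; trans; cong; cong₂; subst; subst₂; isEquivalence; resp₂)
open import Relation.Binary.Structures using (IsStrictPartialOrder)
open import Relation.Nullary using (contradiction)

unique-value : ∀ {K A : Set} {xs : List (K × A)} {k a b} →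
               Unique (map proj₁ xs) → (k , a) ∈ xs → (k , b) ∈ xs → a ≡ b
unique-value _          (here refl) (here refl) = refl
unique-value (k∉ ∷ _)   (here refl) (there b∈)  = contradiction refl (All.lookup k∉ (∈-map⁺ proj₁ b∈))
unique-value (k∉ ∷ _)   (there a∈)  (here refl) = contradiction refl (All.lookup k∉ (∈-map⁺ proj₁ a∈))
unique-value (_ ∷ uniq) (there a∈)  (there b∈)  = unique-value uniq a∈ b∈

module _ (L : Logic) where
  open Logic L
  open Method
  open Body
  open Conforms

  -- Refinement of methods and conformance of bodies.

  ⊑-refl : ∀ {S} → _⊑_ L S S
  ⊑-refl = ⇒-refl , ⇒-refl

  ⊑-trans : ∀ {S₁ S₂ S₃} → _⊑_ L S₁ S₂ → _⊑_ L S₂ S₃ → _⊑_ L S₁ S₃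
  ⊑-trans (pre₁ , post₁) (pre₂ , post₂) = ⇒-trans pre₂ pre₁ , ⇒-trans post₁ post₂

  Refines : Method L → Method L → Set
  Refines M M₀ = SameSignature L M M₀ × _⊑_ L (S M) (S M₀)

  refines-refl : ∀ M → Refines M M
  refines-refl _ = (refl , refl , refl) , ⊑-refl

  refines-trans : ∀ M₁ M₂ M₃ → Refines M₁ M₂ → Refines M₂ M₃ → Refines M₁ M₃
  refines-trans _ _ _ ((n₁ , r₁ , p₁) , ⊑₁) ((n₂ , r₂ , p₂) , ⊑₂) =
    (trans n₁ n₂ , trans r₁ r₂ , trans p₁ p₂) , ⊑-trans ⊑₁ ⊑₂

  sameSignature-sym : ∀ M₁ M₂ → SameSignature L M₁ M₂ → SameSignature L M₂ M₁
  sameSignature-sym _ _ (n , r , p) = sym n , sym r , sym p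

  conforms-refl : ∀ {B} → Conforms L B B
  conforms-refl = record
    { conforms-interfaces = λ C∈ → C∈
    ; conforms-methods    = λ {M} M∈ → M , M∈ , refines-refl M
    }

  conforms-trans : ∀ {B₁ B₂ B₃} → Conforms L B₁ B₂ → Conforms L B₂ B₃ → Conforms L B₁ B₃
  conforms-trans c₁ c₂ = record
    { conforms-interfaces = conforms-interfaces c₁ ∘ conforms-interfaces c₂
    ; conforms-methods    = λ {M₃} M₃∈ →
        let M₂ , M₂∈ , r₂ = conforms-methods c₂ M₃∈
            M₁ , M₁∈ , r₁ = conforms-methods c₁ M₂∈
        in M₁ , M₁∈ , refines-trans M₁ M₂ M₃ r₁ r₂
    }

  -- Headers under composition and `makeAbstract`.

  methodSum-refinesˡ : ∀ {M₁ M₂ M} → MethodSum L M₁ M₂ M → Refines M M₁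
  methodSum-refinesˡ {M₁} (conc-abs _ _ _ _)          = refines-refl M₁
  methodSum-refinesˡ {M₁} {M₂} (abs-conc sig _ _ ⊑)   = sameSignature-sym M₁ M₂ sig , ⊑
  methodSum-refinesˡ {M₁} (abs-abs₁ _ _ _ _)          = refines-refl M₁
  methodSum-refinesˡ {M₁} {M₂} (abs-abs₂ sig _ _ _ ⊑) = sameSignature-sym M₁ M₂ sig , ⊑

  methodSum-refinesʳ : ∀ {M₁ M₂ M} → MethodSum L M₁ M₂ M → Refines M M₂
  methodSum-refinesʳ (conc-abs sig _ _ ⊑)                  = sig , ⊑
  methodSum-refinesʳ {M₂ = M₂} (abs-conc _ _ _ _)          = refines-refl M₂
  methodSum-refinesʳ (abs-abs₁ sig _ _ ⊑)                  = sig , ⊑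
  methodSum-refinesʳ {M₂ = M₂} (abs-abs₂ _ _ _ _ _)        = refines-refl M₂

  methodsSum-refinesˡ : ∀ {Ms₁ Ms₂ Ms M₁} → MethodsSum L Ms₁ Ms₂ Ms → M₁ ∈ Ms₁ →
                        ∃[ M ] (M ∈ Ms × Refines M M₁)
  methodsSum-refinesˡ (keep {M₁} _ _) (here refl) = M₁ , here refl , refines-refl M₁
  methodsSum-refinesˡ (merge sumₘ _)  (here refl) = _ , here refl , methodSum-refinesˡ sumₘ
  methodsSum-refinesˡ (keep _ sum)    (there M₁∈) =
    let M , M∈ , r = methodsSum-refinesˡ sum M₁∈ in M , there M∈ , r
  methodsSum-refinesˡ (merge _ sum)   (there M₁∈) =
    let M , M∈ , r = methodsSum-refinesˡ sum M₁∈ in M , there M∈ , r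

  methodsSum-refinesʳ : ∀ {Ms₁ Ms₂ Ms M₂} → MethodsSum L Ms₁ Ms₂ Ms → M₂ ∈ Ms₂ →
                        ∃[ M ] (M ∈ Ms × Refines M M₂)
  methodsSum-refinesʳ {M₂ = M₂} done M₂∈ = M₂ , M₂∈ , refines-refl M₂
  methodsSum-refinesʳ (keep _ sum) M₂∈ =
    let M , M∈ , r = methodsSum-refinesʳ sum M₂∈ in M , there M∈ , r
  methodsSum-refinesʳ (merge {Ns₁ = Ns₁} sumₘ sum) M₂∈ with ∈-++⁻ Ns₁ M₂∈
  ... | inj₁ M₂∈Ns₁ =
    let M , M∈ , r = methodsSum-refinesʳ sum (∈-++⁺ˡ M₂∈Ns₁) in M , there M∈ , r
  ... | inj₂ (here refl) = _ , here refl , methodSum-refinesʳ sumₘ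
  ... | inj₂ (there M₂∈Ns₂) =
    let M , M∈ , r = methodsSum-refinesʳ sum (∈-++⁺ʳ Ns₁ M₂∈Ns₂) in M , there M∈ , r

  bodySum-conformsˡ : ∀ {B₁ B₂ B} → BodySum L B₁ B₂ B → Conforms L B B₁
  bodySum-conformsˡ (body-sum sum) = record
    { conforms-interfaces = ∈-++⁺ˡ
    ; conforms-methods    = methodsSum-refinesˡ sum
    }

  bodySum-conformsʳ : ∀ {B₁ B₂ B} → BodySum L B₁ B₂ B → Conforms L B B₂
  bodySum-conformsʳ (body-sum {Cs₁ = Cs₁} sum) = record
    { conforms-interfaces = ∈-++⁺ʳ Cs₁
    ; conforms-methods    = methodsSum-refinesʳ sum
    }

  -- `Refines` compares signatures and specifications only, so dropping an implementation loses
  -- nothing.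
  makeAbstract-conforms : ∀ m {B} → Conforms L (makeAbstract L m B) B
  makeAbstract-conforms m = record
    { conforms-interfaces = λ C∈ → C∈
    ; conforms-methods    = λ {M} M∈ → _ , ∈-map⁺ _ M∈ , refines M
    }
    where
    refines : ∀ M → Refines (if name M ≡ᵇ m then header L M else M) M
    refines M with name M ≡ᵇ m
    ... | true  = refines-refl M
    ... | false = refines-refl M

  -- Merging selects one of the two methods and never builds a new one, so any property of single
  -- methods survives composition. It is applied to being OK.
  methodsSum-all : ∀ {P : Method L → Set} {Ms₁ Ms₂ Ms} → MethodsSum L Ms₁ Ms₂ Ms →
                   All P Ms₁ → All P Ms₂ → All P Ms
  methodsSum-all done         _          all₂ = all₂
  methodsSum-all (keep _ sum) (p ∷ all₁) all₂ = p ∷ methodsSum-all sum all₁ all₂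
  methodsSum-all {P} (merge {Ns₁ = Ns₁} sumₘ sum) (p₁ ∷ all₁) all₂ with ++⁻ʳ Ns₁ all₂
  ... | p₂ ∷ allʳ = methodSum-either sumₘ ∷ methodsSum-all sum all₁ (++⁺ (++⁻ˡ Ns₁ all₂) allʳ)
    where
    methodSum-either : ∀ {M} → MethodSum L _ _ M → P M
    methodSum-either (conc-abs _ _ _ _)   = p₁
    methodSum-either (abs-conc _ _ _ _)   = p₂
    methodSum-either (abs-abs₁ _ _ _ _)   = p₁
    methodSum-either (abs-abs₂ _ _ _ _ _) = p₂

  -- Derived laws of the logic.

  ⇒-rename : ∀ {V W} (σ : V → W) {P Q} → ⊢ P ⇒ Q → ⊢ rename σ P ⇒ rename σ Q
  ⇒-rename σ P⇒Q = subst ⊢_ (rename-⇒ σ _ _) (⊢-rename σ P⇒Q)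

  -- Reversing the order of the three conjuncts by commutativity turns `&-assoc` into its converse.
  &-assocʳ : ∀ {V} {P Q R : Formula V} → ⊢ (P & (Q & R)) ⇒ ((P & Q) & R)
  &-assocʳ = ⇒-trans (&-mono ⇒-refl &-comm) (⇒-trans &-comm (⇒-trans &-assoc
             (⇒-trans &-comm (&-mono &-comm ⇒-refl))))

  -- Moving a verified method from trait `t` to `N`.

  module Retyping (V : Verifier L) {Ds : FlatProgram L} {t : TraitName} {N : Name} {B₀ B : Body L}
                  (unique : Unique (map proj₁ Ds))
                  (t∈ : (trait t , B₀) ∈ Ds) (N∈ : (N , B) ∈ Ds) (conforms : Conforms L B B₀) where
    open Verifier V

    -- The possible changes in the type of an expression. A class can only be related to itself, so
    -- a change cannot spread beyond expressions typed by the trait itself.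
    data _↦_ : Name → Name → Set where
      same : ∀ {A} → A ↦ A
      swap : trait t ↦ N

    -- `P ⟿ Q`: the knowledge Q can replace P when trait t is replaced by N.
    -- Given inductively because it must be closed under rename.
    infix 4 _⟿_
    data _⟿_ : Formula Var → Formula Var → Set where
      strengthen : ∀ {P Q} → ⊢ Q ⇒ P → P ⟿ Q
      retype     : ∀ {x} → x ∶ trait t ⟿ x ∶ N
      conj       : ∀ {P₁ P₂ Q₁ Q₂} → P₁ ⟿ Q₁ → P₂ ⟿ Q₂ → P₁ & P₂ ⟿ Q₁ & Q₂

    ⟿-refl : ∀ {P} → P ⟿ P
    ⟿-refl = strengthen ⇒-refl

    ⟿-type : ∀ {x A A′} → A ↦ A′ → x ∶ A ⟿ x ∶ A′
    ⟿-type same = ⟿-refl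
    ⟿-type swap = retype

    ⟿-rename : ∀ σ {P Q} → P ⟿ Q → rename σ P ⟿ rename σ Q
    ⟿-rename σ (strengthen Q⇒P) = strengthen (⇒-rename σ Q⇒P)
    ⟿-rename σ retype           = subst₂ _⟿_ (sym (rename-∶ σ _ _)) (sym (rename-∶ σ _ _)) retype
    ⟿-rename σ (conj r₁ r₂)     =
      subst₂ _⟿_ (sym (rename-& σ _ _)) (sym (rename-& σ _ _)) (conj (⟿-rename σ r₁) (⟿-rename σ r₂))

    ⟿-⋀ : ∀ {Ps Qs} → Pointwise _⟿_ Ps Qs → ⋀ L Ps ⟿ ⋀ L Qs
    ⟿-⋀ []       = ⟿-refl
    ⟿-⋀ (r ∷ rs) = conj r (⟿-⋀ rs)

    ⟿-zipWith-& : ∀ {Ps Qs} → Pointwise _⟿_ Ps Qs → ∀ Rs →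
                  ⋀ L (zipWith _&_ Ps Rs) ⟿ ⋀ L (zipWith _&_ Qs Rs)
    ⟿-zipWith-& []       _        = ⟿-refl
    ⟿-zipWith-& (_ ∷ _)  []       = ⟿-refl
    ⟿-zipWith-& (r ∷ rs) (_ ∷ Rs) = conj (conj r ⟿-refl) (⟿-zipWith-& rs Rs)

    -- The frame `R` makes the induction work: in a conjunction one conjunct is replaced at a time,
    -- while the other is parked in the frame by commutativity and associativity.
    ⟿-sound : ∀ {P Q R G} → P ⟿ Q → Ds ⊢ P & R ⊨ G → Ds ⊢ Q & R ⊨ G
    ⟿-sound (strengthen Q⇒P) = consequence (&-mono Q⇒P ⇒-refl) ⇒-refl
    ⟿-sound retype           = modular unique t∈ N∈ conforms
    ⟿-sound (conj r₁ r₂)     =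
      consequence (⇒-trans (&-mono &-comm ⇒-refl) &-assoc) ⇒-refl
      ∘ ⟿-sound r₂
      ∘ consequence (⇒-trans &-assocʳ (⇒-trans (&-mono &-comm ⇒-refl) &-assoc)) ⇒-refl
      ∘ ⟿-sound r₁
      ∘ consequence &-assocʳ ⇒-refl

    ↦-body : ∀ {A A′ B₁} → A ↦ A′ → (A , B₁) ∈ Ds → ∃[ B₂ ] ((A′ , B₂) ∈ Ds × Conforms L B₂ B₁)
    ↦-body same B₁∈ = _ , B₁∈ , conforms-refl
    ↦-body swap B₁∈ = _ , N∈ , subst (Conforms L B) (unique-value unique t∈ B₁∈) conforms

    -- A proper step leads to an interface, which is a class, and conformance keeps every interface
    -- of the old body. Hence after one step both chains coincide.
    ↦-subtype : ∀ {A₁ A₂ A₁′} → A₁ ↦ A₁′ → Subtype L Ds A₁ A₂ →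
                ∃[ A₂′ ] (A₂ ↦ A₂′ × Subtype L Ds A₁′ A₂′)
    ↦-subtype A₁↦ sub-refl              = _ , A₁↦ , sub-refl
    ↦-subtype A₁↦ (sub-step B₁∈ C∈ sub) =
      let _ , B₂∈ , conf = ↦-body A₁↦ B₁∈
      in _ , same , sub-step B₂∈ (conforms-interfaces conf C∈) sub

    ↦-context : ∀ {x A Γ} → (x , A) ∈ ((this , trait t) ∷ Γ) →
                ∃[ A′ ] (A ↦ A′ × (x , A′) ∈ ((this , N) ∷ Γ))
    ↦-context (here refl) = N , swap , here refl
    ↦-context (there x∈)  = _ , same , there x∈

    -- The generated variables `ks` are kept, so the freshness conditions carry over unchanged.
    -- Knowledge needs `⟿`, as it may mention the type of `this`; for obligations, plain implication
    -- suffices.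
    retype-expr : ∀ {Γ e A P P′ ks} → Typed L Ds ((this , trait t) ∷ Γ) e A P P′ ks →
      ∃[ A′ ] ∃[ Q ] ∃[ Q′ ] (A ↦ A′ × Typed L Ds ((this , N) ∷ Γ) e A′ Q Q′ ks × P ⟿ Q × ⊢ P′ ⇒ Q′)

    retype-args : ∀ {Γ es Cs xs Ps Ps′ ks} → TypedArgs L Ds ((this , trait t) ∷ Γ) es Cs xs Ps Ps′ ks →
      ∃[ Qs ] ∃[ Qs′ ] (TypedArgs L Ds ((this , N) ∷ Γ) es Cs xs Qs Qs′ ks ×
                        Pointwise _⟿_ Ps Qs × ⊢ ⋀ L Ps′ ⇒ ⋀ L Qs′)

    retype-expr (t-var x∈) =
      let _ , A↦ , x∈′ = ↦-context x∈
      in _ , _ , _ , A↦ , t-var x∈′ , conj (⟿-type A↦) ⟿-refl , ⇒-refl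
    retype-expr (t-call e₀ B₁∈ M∈ es uniq)
      with retype-expr e₀ | retype-args es
    ... | _ , _ , _ , A₀↦ , e₀′ , know₀ , obl₀ | _ , _ , es′ , knows , obls
      with ↦-body A₀↦ B₁∈
    ... | _ , B₂∈ , conf with conforms-methods conf M∈
    -- Equal signatures make the substitution and the argument types coincide. The new precondition
    -- is weaker and the new postcondition stronger, so `pre ⇒ post` gains strength as knowledge
    -- while the obligation `pre` weakens.
    ... | method _ _ _ _ _ , M₂∈ , (refl , refl , refl) , pre⇒ , post⇒ =
      _ , _ , _ , same , t-call e₀′ B₂∈ M₂∈ es′ uniq
      , conj ⟿-refl (conj (⟿-rename _ know₀) (conj (⟿-⋀ knows)
          (strengthen (⇒-mono (⇒-rename _ pre⇒) (⇒-rename _ post⇒)))))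
      , &-mono obl₀ (&-mono obls (⇒-rename _ pre⇒))
    -- The instantiated class is not affected by retyping, so its getters and their specifications
    -- stay literally the same.
    retype-expr (t-new C∈ es uniq) =
      let _ , _ , es′ , knows , obls = retype-args es
      in _ , _ , _ , same , t-new C∈ es′ uniq
         , conj ⟿-refl (⟿-zipWith-& knows _) , &-mono obls ⇒-refl
    retype-expr (t-sub e sub) =
      let _ , _ , _ , A↦ , e′ , know , obl = retype-expr e
          _ , A₂↦ , sub′ = ↦-subtype A↦ sub
      in _ , _ , _ , A₂↦ , t-sub e′ sub′ , know , obl

    retype-args [] = _ , _ , [] , [] , ⇒-refl
    retype-args (e ∷ es) with retype-expr e
    -- Parameter types are classes, which rules out `swap`.
    ... | _ , _ , _ , same , e′ , know , obl =
      let _ , _ , es′ , knows , obls = retype-args es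
      in _ , _ , e′ ∷ es′ , ⟿-rename _ know ∷ knows , &-mono obl obls

    retype-method : ∀ {M} → MethodOK L V Ds (trait t) M → MethodOK L V Ds N M
    retype-method (abstract-ok eq) = abstract-ok eq
    retype-method (concrete-ok eq e proof) with retype-expr e
    ... | _ , _ , _ , same , e′ , know , obl =
      concrete-ok eq e′
        -- All hypotheses take part in the replacement, so `tt` serves as the empty frame. The inner
        -- `retype` acts on the assumption about `this`, the head of the context formula.
        (consequence &-tt-intro (&-mono obl ⇒-refl)
          (⟿-sound (conj (conj retype ⟿-refl) (conj ⟿-refl know))
            (consequence &-tt-elim ⇒-refl proof)))

  -- Flattening a single declaration.

  module _ (V : Verifier L) {Ds : FlatProgram L} where

    makeAbstract-ok : ∀ m {N B} → BodyOK L V Ds N B → BodyOK L V Ds N (makeAbstract L m B)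
    makeAbstract-ok m {N} = map⁺ ∘ All.map abstracted
      where
      abstracted : ∀ {M} → MethodOK L V Ds N M →
                   MethodOK L V Ds N (if name M ≡ᵇ m then header L M else M)
      abstracted {M} ok with name M ≡ᵇ m
      ... | true  = abstract-ok refl
      ... | false = ok

    -- `B` is the final body of `N`, and `B′` that of a subexpression. Carrying their conformance
    -- down the expression provides what retyping needs at a trait reference; a literal was already
    -- checked under `N` itself.
    flatten-ok : ∀ {N B E B′} → Unique (map proj₁ Ds) → (N , B) ∈ Ds →
      (∀ {t B₀} → t ∈ traits L E → (trait t , B₀) ∈ Ds → BodyOK L V Ds (trait t) B₀) →
      Flatten L V Ds N E B′ → Conforms L B B′ → BodyOK L V Ds N B′
    flatten-ok uniq N∈ traits-ok (f-body _ ok) _ = ok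
    flatten-ok uniq N∈ traits-ok (f-ref t∈) conf =
      All.map (Retyping.retype-method V uniq t∈ N∈ conf) (traits-ok (here refl) t∈)
    flatten-ok uniq N∈ traits-ok (f-sum {E₁ = E₁} fl₁ fl₂ sum@(body-sum msum)) conf =
      methodsSum-all msum
        (flatten-ok uniq N∈ (traits-ok ∘ ∈-++⁺ˡ) fl₁
          (conforms-trans conf (bodySum-conformsˡ sum)))
        (flatten-ok uniq N∈ (traits-ok ∘ ∈-++⁺ʳ (traits L E₁)) fl₂
          (conforms-trans conf (bodySum-conformsʳ sum)))
    flatten-ok uniq N∈ traits-ok (f-abs {B = B₁} {m = m} fl) conf =
      makeAbstract-ok m {B = B₁}
        (flatten-ok uniq N∈ traits-ok fl (conforms-trans conf (makeAbstract-conforms m)))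

    flattenDecl-name : ∀ {d d′} → FlattenDecl L V Ds d d′ → proj₁ d ≡ proj₁ d′
    flattenDecl-name (f-trait _)   = refl
    flattenDecl-name (f-class _ _) = refl

    flattenDecl-flatten : ∀ {N E B} → FlattenDecl L V Ds (N , E) (N , B) → Flatten L V Ds N E B
    flattenDecl-flatten (f-trait fl)   = fl
    flattenDecl-flatten (f-class fl _) = fl

    flattened-names : ∀ {Es Bs} → Pointwise (FlattenDecl L V Ds) Es Bs → map proj₁ Es ≡ map proj₁ Bs
    flattened-names []       = refl
    flattened-names (d ∷ ds) = cong₂ _∷_ (flattenDecl-name d) (flattened-names ds)

    flattened-source : ∀ {Es Bs N B} → Pointwise (FlattenDecl L V Ds) Es Bs → (N , B) ∈ Bs →
                       ∃[ E ] ((N , E) ∈ Es × Flatten L V Ds N E B)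
    flattened-source (d ∷ _) (here refl) with refl ← flattenDecl-name d =
      _ , here refl , flattenDecl-flatten d
    flattened-source (_ ∷ ds) (there B∈) =
      let E , E∈ , fl = flattened-source ds B∈ in E , there E∈ , fl

  -- Induction along trait references.

  module _ {Ds : Program L} (wf : WellFormed L Ds) where
    open WellFormed wf

    -- Trait expressions never refer to classes, so every trait may be placed
    -- before every class.
    data Before : Name → Name → Set where
      used  : ∀ {t u} → TransClosure (Uses L Ds) t u → Before (trait u) (trait t)
      first : ∀ {u C} → Before (trait u) (class C)

    uses⇒before : ∀ {N E u} → (N , E) ∈ Ds → u ∈ traits L E → Before (trait u) N
    uses⇒before {trait t} E∈ u∈ = used [ _ , E∈ , u∈ ]
    uses⇒before {class C} E∈ u∈ = first

    before-isStrictPartialOrder : IsStrictPartialOrder _≡_ Before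
    before-isStrictPartialOrder = record
      { isEquivalence = isEquivalence
      ; irrefl        = λ { refl (used cycle) → acyclic _ cycle }
      ; trans         = λ { (used p) (used q) → used (q ++ p) ; (used _) first → first }
      ; <-resp-≈      = resp₂ Before
      }

    declName : Fin (length Ds) → Name
    declName = proj₁ ∘ lookup Ds

    -- The order is pulled back to the positions in `Ds`, which are finite in number, and a strict
    -- partial order on a finite set is well-founded.
    before-wellFounded : WellFounded (Before on declName)
    before-wellFounded =
      spo-wellFounded (On.isStrictPartialOrder declName before-isStrictPartialOrder)

    declName-index : ∀ {N E} (E∈ : (N , E) ∈ Ds) → declName (index E∈) ≡ N
    declName-index E∈ = sym (cong proj₁ (lookup-index E∈))

    flattened-ok : (V : Verifier L) {Ds′ : FlatProgram L} → FlattensTo L V Ds Ds′ →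
                   ∀ {N B} → (N , B) ∈ Ds′ → BodyOK L V Ds′ N B
    flattened-ok V {Ds′} flat B∈ =
      let _ , E∈ , _ = flattened-source V flat B∈
      in go (before-wellFounded (index E∈)) (declName-index E∈) B∈
      where
      go : ∀ {i N B} → Acc (Before on declName) i → declName i ≡ N →
           (N , B) ∈ Ds′ → BodyOK L V Ds′ N B
      go {i} (acc rs) refl B∈ =
        let _ , E∈ , fl = flattened-source V flat B∈
        in flatten-ok V (subst Unique (flattened-names V flat) unique-names) B∈
             -- A referenced trait with a flattened body also has a source declaration, whose
             -- position is smaller.
             (λ u∈ B₀∈ →
               let _ , E₀∈ , _ = flattened-source V flat B₀∈
                   eq = declName-index E₀∈
               in go (rs (subst (λ n → Before n (declName i)) (sym eq) (uses⇒before E∈ u∈))) eq B₀∈)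
             fl conforms-refl

theorem4p8 : (L : Logic) (V : Verifier L) (Ds : Program L) (Ds′ : FlatProgram L) →
    WellFormed L Ds → FlattensTo L V Ds Ds′ →
    ∀ (N : Name) (B : Body L) → (N , B) ∈ Ds′ → BodyOK L V Ds′ N B
theorem4p8 L V Ds Ds′ wf flat N B = flattened-ok L wf V flat
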